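{- Let $q$ be any prime power, let $d\ge2$, fix a nondegenerate bilinear pairing $\langle\cdot,\cdot\rangle$ on $\mathbb F_q^d$, let $Y\subseteq\mathbb F_q^d$ be nonempty, and let $T\subseteq\mathbb F_q^d$ be a set of $m\ge2$ pairwise nonproportional nonzero pins. Suppose $$|\Pi_p(Y)|\le(1-\alpha)q\qquad(p\in T)$$ for some $0<\alpha<1$ and let $C_1\ge1$, and suppose $$(1-\alpha)^3mq^3\le C_1^2\alpha^2|Y|.$$ Then there exist distinct pins $p,p'\in T$ and attained values $t\in\Pi_p(Y)$, $t'\in\Pi_{p'}(Y)$ for which $$|\{x\in Y:\langle p,x\rangle=t,\ \langle p',x\rangle=t'\}|\ge\frac{\alpha}{8C_1\sqrt{1-\alpha}}\sqrt{\frac{m|Y|}q}.\tag{*}$$ At least $$\frac{3|Y|m(m-1)}{4q^{d-2}}$$ ordered choices $((p,t),(p',t'))$ (with $p\ne p'$ in $T$, $t\in\Pi_p(Y)$, $t'\in\Pi_{p'}(Y)$) satisfy (*).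
   Context: $\Pi_p(Y)=\{\langle p,x\rangle:x\in Y\}$. -}

module Defs where

open import Algebra.Bundles using (CommutativeRing; Semiring)
open import Algebra.Core using (Op₁; Op₂)
open import Algebra.Structures using (IsCommutativeRing)
import Algebra.Definitions.RawMonoid as RawMonoidDefinitions
import Algebra.Definitions.RawSemiring as RawSemiringDefinitions
import Algebra.Properties.Ring as RingProperties
open import Data.Empty using (⊥-elim)
open import Data.Fin.Base using (Fin)
open import Data.Fin.Properties using (inj⇒≟; nonZeroIndex)
open import Data.List.Base using (List; length; map; filter; deduplicate)
import Data.List.Membership.Propositional as ListMembership
open import Data.List.Relation.Unary.Unique.Propositional using (Unique)
import Data.List.Relation.Unary.Unique.Propositional.Properties as Unique
import Data.List.Relation.Unary.Unique.DecPropositional.Properties as UniqueDec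
open import Data.Nat.Base as ℕ using (ℕ; zero; suc; NonZero; _∸_)
open import Data.Nat.Primality using (Prime)
import Data.Nat.Properties as ℕ
open import Data.Product.Base using (∃; ∃-syntax; _×_; _,_; proj₁; proj₂)
open import Data.Sum.Base using (_⊎_; inj₁; inj₂)
open import Data.Vec.Base as Vec using (Vec)
open import Function.Bundles using (_↔_; Inverse)
open import Function.Properties.Inverse using (↔⇒↣)
open import Level using (_⊔_; 0ℓ) renaming (suc to lsuc)
open import Relation.Binary.Core using (Rel)
open import Relation.Binary.Definitions using (DecidableEquality)
open import Relation.Binary.PropositionalEquality
  using (_≡_; _≢_)
open import Relation.Binary.Structures using (IsStrictPartialOrder)
open import Relation.Nullary using (¬_)
open import Relation.Nullary.Decidable using (_×-dec_)
open import Relation.Unary using (Pred; Decidable)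

-- The real numbers, axiomatised as a Cauchy-complete Archimedean ordered
-- field.  Classically this determines ℝ up to isomorphism; the axioms are
-- phrased so that constructive (Cauchy or Dedekind) reals satisfy them too:
-- the strict order is primitive, x ≤ y means ¬ (y < x), and neither
-- trichotomy nor decidability is assumed.  As in other treatments of √ as a
-- total function, √ x is unspecified for negative x.  Since ≈ is tight,
-- √ x is uniquely determined for x ≥ 0.
record Reals c ℓ₁ ℓ₂ : Set (lsuc (c ⊔ ℓ₁ ⊔ ℓ₂)) where
  infix 4 _<_ _≤_
  field
    commutativeRing : CommutativeRing c ℓ₁

  open CommutativeRing commutativeRing public
  open RawMonoidDefinitions +-rawMonoid using () renaming (_×_ to _times_)
  open RawSemiringDefinitions (Semiring.rawSemiring semiring) public using (_^_)

  field
    _<_ : Rel Carrier ℓ₂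
    √_  : Op₁ Carrier

  _≤_ : Rel Carrier ℓ₂
  x ≤ y = ¬ (y < x)

  fromℕ : ℕ → Carrier
  fromℕ n = n times 1#

  IsCauchy : (ℕ → Carrier) → Set (c ⊔ ℓ₂)
  IsCauchy s = ∀ ε → 0# < ε →
    ∃[ N ] (∀ m n → N ℕ.≤ m → N ℕ.≤ n → s m - s n < ε)

  _ConvergesTo_ : (ℕ → Carrier) → Carrier → Set (c ⊔ ℓ₂)
  s ConvergesTo l = ∀ ε → 0# < ε →
    ∃[ N ] (∀ n → N ℕ.≤ n → (s n - l < ε) × (l - s n < ε))

  field
    <-isStrictPartialOrder : IsStrictPartialOrder _≈_ _<_
    <-cotrans   : ∀ {x y} → x < y → ∀ z → (x < z) ⊎ (z < y)
    <-tight     : ∀ {x y} → x ≤ y → y ≤ x → x ≈ y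
    0<1         : 0# < 1#
    +-monoˡ-<   : ∀ {x y} z → x < y → x + z < y + z
    *-positive  : ∀ {x y} → 0# < x → 0# < y → 0# < x * y
    reciprocal  : ∀ {x} → 0# < x → ∃[ y ] (0# < y × x * y ≈ 1#)
    √-nonneg    : ∀ {x} → 0# ≤ x → 0# ≤ √ x
    √-square    : ∀ {x} → 0# ≤ x → √ x * √ x ≈ x
    archimedean : ∀ x → ∃[ n ] (x < fromℕ n)
    complete    : ∀ s → IsCauchy s → ∃[ l ] (s ConvergesTo l)

  open IsStrictPartialOrder <-isStrictPartialOrder public
    using (<-respˡ-≈; <-respʳ-≈)
    renaming (trans to <-trans; irrefl to <-irrefl; asym to <-asym)

  infixl 7 _/_[_]
  _/_[_] : Carrier → (y : Carrier) → 0# < y → Carrier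
  x / y [ 0<y ] = x * proj₁ (reciprocal 0<y)

  private
    open RingProperties ring using (-‿distribˡ-*)

    neg-pos : ∀ {x} → x < 0# → 0# < - x
    neg-pos {x} x<0 = <-respˡ-≈ (-‿inverseʳ x)
      (<-respʳ-≈ (+-identityˡ (- x)) (+-monoˡ-< (- x) x<0))

    pos-neg : ∀ {x} → 0# < - x → x < 0#
    pos-neg {x} 0<-x = <-respˡ-≈ (+-identityˡ x)
      (<-respʳ-≈ (-‿inverseˡ x) (+-monoˡ-< x 0<-x))

    *-nonneg-pos : ∀ {x y} → 0# ≤ x → 0# < y → 0# ≤ x * y
    *-nonneg-pos {x} {y} 0≤x 0<y xy<0 with reciprocal 0<y
    ... | z , 0<z , yz≈1 = 0≤x (pos-neg (<-respʳ-≈ eq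
            (*-positive (neg-pos xy<0) 0<z)))
      where
        eq : - (x * y) * z ≈ - x
        eq = trans (*-congʳ (-‿distribˡ-* x y))
               (trans (*-assoc (- x) y z)
                 (trans (*-congˡ yz≈1) (*-identityʳ (- x))))

  difference-pos : ∀ {x y} → x < y → 0# < y - x
  difference-pos {x} x<y = <-respˡ-≈ (-‿inverseʳ x) (+-monoˡ-< (- x) x<y)

  1≤⇒pos : ∀ {x} → 1# ≤ x → 0# < x
  1≤⇒pos {x} 1≤x with <-cotrans 0<1 x
  ... | inj₁ 0<x = 0<x
  ... | inj₂ x<1 = ⊥-elim (1≤x x<1)

  fromℕ-pos : ∀ n → .{{NonZero n}} → 0# < fromℕ n
  fromℕ-pos (suc zero)      = <-respʳ-≈ (sym (+-identityʳ 1#)) 0<1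
  fromℕ-pos (suc n@(suc _)) = <-trans (fromℕ-pos n)
    (<-respˡ-≈ (+-identityˡ (fromℕ n)) (+-monoˡ-< (fromℕ n) 0<1))

  √-pos : ∀ {x} → 0# < x → 0# < √ x
  √-pos {x} 0<x with <-cotrans 0<x (√ x) | <-cotrans 0<1 (√ x)
  ... | inj₁ 0<s | _        = 0<s
  ... | inj₂ _   | inj₁ 0<s = 0<s
  ... | inj₂ s<x | inj₂ s<1 = ⊥-elim (absurd s<x)
    where
      s = √ x
      0≤x : 0# ≤ x
      0≤x = <-asym 0<x
      eq : s * (1# - s) ≈ s - x
      eq = trans (distribˡ s 1# (- s))
             (+-cong (*-identityʳ s)
               (trans (sym (RingProperties.-‿distribʳ-* ring s s))
                      (-‿cong (√-square 0≤x))))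
      absurd : ¬ (s < x)
      absurd s<x = *-nonneg-pos (√-nonneg 0≤x) (difference-pos s<1)
        (<-respˡ-≈ (sym eq)
          (<-respʳ-≈ (-‿inverseʳ x) (+-monoˡ-< (- x) s<x)))

IsPrimePower : ℕ → Set
IsPrimePower q = ∃[ p ] ∃[ k ] (Prime p × 1 ℕ.≤ k × q ≡ p ℕ.^ k)

record FiniteField (q : ℕ) : Set₁ where
  infixl 6 _+_
  infixl 7 _*_
  field
    Carrier           : Set
    _+_ _*_           : Op₂ Carrier
    -_                : Op₁ Carrier
    0# 1#             : Carrier
    isCommutativeRing : IsCommutativeRing _≡_ _+_ _*_ -_ 0# 1#
    0≢1               : 0# ≢ 1#
    inverse           : ∀ x → x ≢ 0# → ∃[ y ] (x * y ≡ 1#)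
    enumeration       : Carrier ↔ Fin q

  _≟_ : DecidableEquality Carrier
  _≟_ = inj⇒≟ (↔⇒↣ enumeration)

  order-nonZero : NonZero q
  order-nonZero = nonZeroIndex (Inverse.to enumeration 0#)

-- Finite sets over a type with its propositional equality, presented by
-- their duplicate-free enumerations, so that cardinality is list length.
record FinSet {a} (A : Set a) : Set a where
  constructor _,_
  field
    elements : List A
    unique   : Unique elements

module _ {a} {A : Set a} where
  infix 4 _∈_

  _∈_ : A → FinSet A → Set a
  x ∈ S = x ListMembership.∈ FinSet.elements S

  ∣_∣ : FinSet A → ℕ
  ∣ S ∣ = length (FinSet.elements S)

  Nonempty : FinSet A → Set a
  Nonempty S = ∃[ x ] (x ∈ S)

  separate : ∀ {p} {P : Pred A p} → Decidable P → FinSet A → FinSet A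
  separate P? (xs , u) = filter P? xs , Unique.filter⁺ P? u

  image : ∀ {b} {B : Set b} → DecidableEquality B → (A → B) → FinSet A → FinSet B
  image _≟_ f (xs , _) =
    deduplicate _≟_ (map f xs) , UniqueDec.deduplicate-! _≟_ (map f xs)

module _ {q : ℕ} (F : FiniteField q) (d : ℕ) where
  open FiniteField F

  Vector : Set
  Vector = Vec Carrier d

  0ᵥ : Vector
  0ᵥ = Vec.replicate d 0#

  _+ᵥ_ : Op₂ Vector
  _+ᵥ_ = Vec.zipWith _+_

  _·ᵥ_ : Carrier → Vector → Vector
  c ·ᵥ v = Vec.map (c *_) v

  Proportional : Rel Vector 0ℓ
  Proportional u v = ∃[ c ] (u ≡ c ·ᵥ v)

  PairwiseNonproportional : FinSet Vector → Set
  PairwiseNonproportional T =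
    ∀ {u v} → u ∈ T → v ∈ T → u ≢ v → ¬ Proportional u v

  record NondegeneratePairing : Set where
    field
      ⟨_,_⟩          : Vector → Vector → Carrier
      +-linearˡ      : ∀ u v w → ⟨ u +ᵥ v , w ⟩ ≡ ⟨ u , w ⟩ + ⟨ v , w ⟩
      ·-linearˡ      : ∀ c u w → ⟨ c ·ᵥ u , w ⟩ ≡ c * ⟨ u , w ⟩
      +-linearʳ      : ∀ u v w → ⟨ u , v +ᵥ w ⟩ ≡ ⟨ u , v ⟩ + ⟨ u , w ⟩
      ·-linearʳ      : ∀ c u w → ⟨ u , c ·ᵥ w ⟩ ≡ c * ⟨ u , w ⟩
      nondegenerateˡ : ∀ u → (∀ w → ⟨ u , w ⟩ ≡ 0#) → u ≡ 0ᵥ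
      nondegenerateʳ : ∀ w → (∀ u → ⟨ u , w ⟩ ≡ 0#) → w ≡ 0ᵥ

module Pins {q : ℕ} {F : FiniteField q} {d : ℕ}
            (pairing : NondegeneratePairing F d) where
  open FiniteField F using (_≟_) renaming (Carrier to 𝔽)
  open NondegeneratePairing pairing

  Π : Vector F d → FinSet (Vector F d) → FinSet 𝔽
  Π p Y = image _≟_ (λ x → ⟨ p , x ⟩) Y

  -- A choice of two (pin, value) pairs; the order of the two matters.
  Choice : Set
  Choice = (Vector F d × 𝔽) × (Vector F d × 𝔽)

  IsAdmissible : (Y T : FinSet (Vector F d)) → Choice → Set
  IsAdmissible Y T ((p , t) , (p′ , t′)) =
    p ∈ T × p′ ∈ T × p ≢ p′ × t ∈ Π p Y × t′ ∈ Π p′ Y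

  jointFibre : FinSet (Vector F d) → Choice → FinSet (Vector F d)
  jointFibre Y ((p , t) , (p′ , t′)) =
    separate (λ x → (⟨ p , x ⟩ ≟ t) ×-dec (⟨ p′ , x ⟩ ≟ t′)) Y

module Bounds {c ℓ₁ ℓ₂} (ℝ : Reals c ℓ₁ ℓ₂) {q : ℕ} (F : FiniteField q) where
  open Reals ℝ

  -- Below, m and y stand for the numbers of pins and of points.

  richnessBound : (m y : ℕ) (α C₁ : Carrier) → α < 1# → 1# ≤ C₁ → Carrier
  richnessBound m y α C₁ α<1 1≤C₁ =
    (α / (fromℕ 8 * C₁ * √ (1# - α)) [ denominator-pos ])
      * √ (fromℕ (m ℕ.* y) / fromℕ q [ q-pos ])
    where
      denominator-pos : 0# < fromℕ 8 * C₁ * √ (1# - α)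
      denominator-pos = *-positive (*-positive (fromℕ-pos 8) (1≤⇒pos 1≤C₁))
                                   (√-pos (difference-pos α<1))
      q-pos : 0# < fromℕ q
      q-pos = fromℕ-pos q {{FiniteField.order-nonZero F}}

  countBound : (m y d : ℕ) → Carrier
  countBound m y d =
    fromℕ (3 ℕ.* y ℕ.* m ℕ.* (m ∸ 1)) / fromℕ (4 ℕ.* q ℕ.^ (d ∸ 2)) [ pos ]
    where
      pos : 0# < fromℕ (4 ℕ.* q ℕ.^ (d ∸ 2))
      pos = fromℕ-pos (4 ℕ.* q ℕ.^ (d ∸ 2))
        {{ℕ.m*n≢0 4 (q ℕ.^ (d ∸ 2))
          {{_}} {{ℕ.m^n≢0 q (d ∸ 2) {{FiniteField.order-nonZero F}}}}}}

{-# OPTIONS --safe #-}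
module Submission where

-- Two pins p ≠ p′ cut Y into |Π_p(Y)| |Π_p′(Y)| ≤ (1-α)² q² cells.  Call a cell
-- heavy if it holds at least a quarter of the average number of points.  The
-- density hypothesis says that even (1/8) |Y| / ((1-α)² q²) exceeds the bound in
-- (*), so heavy cells are rich; unlike richness, heaviness is decidable.  The
-- light cells together hold at most |Y| / 4 points, and a cell, contained in an
-- affine subspace of codimension 2, holds at most q^(d-2); hence each of the
-- m (m-1) ordered pairs of pins has at least 3 |Y| / (4 q^(d-2)) heavy cells.

open import Defs
open import Data.Nat.Base as ℕ using (ℕ)
open import Data.Product.Base using (∃; _×_)
open import Relation.Binary.PropositionalEquality using (_≢_)

open import Algebra.Bundles using (CommutativeRing)
import Algebra.Properties.Group as GroupProperties
import Algebra.Properties.Ring as RingProperties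
import Algebra.Properties.Semiring.Mult as SemiringMult
import Algebra.Solver.Ring.NaturalCoefficients.Default as RingSolver
open import Data.Empty using (⊥-elim)
open import Data.List.Base
  using (List; []; _∷_; _++_; length; map; filter; concatMap; allFin;
         cartesianProduct; cartesianProductWith)
open import Data.List.Membership.Propositional using (find; lose) renaming (_∈_ to _∈ₗ_)
open import Data.List.Membership.Propositional.Properties
open import Data.List.Properties using (length-map; length-++; length-++-sucʳ; length-tabulate)
open import Data.List.Relation.Unary.All as All using ()
open import Data.List.Relation.Unary.AllPairs using ([]; _∷_)
open import Data.List.Relation.Unary.Any using (here; there)
open import Data.List.Relation.Unary.Unique.Propositional using (Unique)
import Data.List.Relation.Unary.Unique.Propositional.Properties as Unique
import Data.Nat.Properties as ℕ
open import Data.Nat.Tactic.RingSolver using (solve-∀)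
open import Data.Product.Base using (_,_; proj₁; proj₂)
open import Data.Product.Properties using (,-injectiveʳ)
open import Data.Sum.Base using (inj₁; inj₂)
open import Data.Vec.Base using ([]; _∷_)
open import Data.Vec.Properties using (∷-injectiveˡ; ∷-injectiveʳ; ≡-dec)
open import Function.Base using (_∘_; id)
open import Function.Bundles using (Inverse)
open import Relation.Binary.Definitions using (DecidableEquality)
open import Relation.Binary.PropositionalEquality
  using (_≡_; refl; sym; trans; cong; cong₂; subst; module ≡-Reasoning)
open import Relation.Nullary using (¬_; yes; no)
open import Relation.Nullary.Decidable using (¬?; decidable-stable)
open import Relation.Unary using (Decidable)

-- Counting in lists without duplicates.

unique-⊆⇒length≤ : ∀ {a} {A : Set a} {xs ys : List A} → Unique xs →
  (∀ {x} → x ∈ₗ xs → x ∈ₗ ys) → length xs ℕ.≤ length ys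
unique-⊆⇒length≤ [] _ = ℕ.z≤n
unique-⊆⇒length≤ {xs = x ∷ xs} (x∉xs ∷ u) xs⊆ys with ∈-∃++ (xs⊆ys (here refl))
-- Delete from `ys` the occurrence of `x` at the split. As `xs` has no duplicates, the other
-- elements of `xs` differ from `x` and survive the deletion.
... | as , bs , refl = ℕ.≤-trans (ℕ.s≤s (unique-⊆⇒length≤ u remove))
                                 (ℕ.≤-reflexive (sym (length-++-sucʳ as x bs)))
  where
  remove : ∀ {z} → z ∈ₗ xs → z ∈ₗ as ++ bs
  remove z∈xs with ∈-++⁻ as (xs⊆ys (there z∈xs))
  ... | inj₁ z∈as         = ∈-++⁺ˡ z∈as
  ... | inj₂ (there z∈bs) = ∈-++⁺ʳ as z∈bs
  ... | inj₂ (here refl)  = ⊥-elim (All.lookup x∉xs z∈xs refl)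

module _ {a b} {A : Set a} {B : Set b} {f : A → List B} where

  -- `π` reads off from an element the index of its block, so blocks with different indices are
  -- disjoint.
  concatMap-unique : (π : B → A) → (∀ x → Unique (f x)) →
    (∀ x {z} → z ∈ₗ f x → π z ≡ x) →
    ∀ {xs} → Unique xs → Unique (concatMap f xs)
  concatMap-unique π uf πf [] = []
  concatMap-unique π uf πf {x ∷ xs} (x∉xs ∷ u) =
    Unique.++⁺ (uf x) (concatMap-unique π uf πf u) disjoint
    where
    disjoint : ∀ {z} → ¬ (z ∈ₗ f x × z ∈ₗ concatMap f xs)
    disjoint (z∈fx , z∈rest) with find (∈-concatMap⁻ f {xs = xs} z∈rest)
    ... | x′ , x′∈xs , z∈fx′ =
      All.lookup x∉xs x′∈xs (trans (sym (πf x z∈fx)) (πf x′ z∈fx′))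

  -- Each block has at least `c / k` elements; the factor `k` stays on the right so that no division
  -- of naturals occurs.
  length-concatMap-≥ : ∀ c k xs →
    (∀ {x} → x ∈ₗ xs → c ℕ.≤ k ℕ.* length (f x)) →
    length xs ℕ.* c ℕ.≤ k ℕ.* length (concatMap f xs)
  length-concatMap-≥ c k [] _ = ℕ.z≤n
  length-concatMap-≥ c k (x ∷ xs) h = begin
    c ℕ.+ length xs ℕ.* c
      ≤⟨ ℕ.+-mono-≤ (h (here refl)) (length-concatMap-≥ c k xs (h ∘ there)) ⟩
    k ℕ.* length (f x) ℕ.+ k ℕ.* length (concatMap f xs)
      ≡⟨ ℕ.*-distribˡ-+ k (length (f x)) _ ⟨
    k ℕ.* (length (f x) ℕ.+ length (concatMap f xs))
      ≡⟨ cong (k ℕ.*_) (length-++ (f x)) ⟨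
    k ℕ.* length (f x ++ concatMap f xs) ∎
    where open ℕ.≤-Reasoning

length-cartesianProductWith : ∀ {a b c} {A : Set a} {B : Set b} {C : Set c}
  (f : A → B → C) xs ys →
  length (cartesianProductWith f xs ys) ≡ length xs ℕ.* length ys
length-cartesianProductWith f []       ys = refl
length-cartesianProductWith f (x ∷ xs) ys = begin
  length (map (f x) ys ++ cartesianProductWith f xs ys)
    ≡⟨ length-++ (map (f x) ys) ⟩
  length (map (f x) ys) ℕ.+ length (cartesianProductWith f xs ys)
    ≡⟨ cong₂ ℕ._+_ (length-map (f x) ys) (length-cartesianProductWith f xs ys) ⟩
  length ys ℕ.+ length xs ℕ.* length ys ∎
  where open ≡-Reasoning

-- Averaging: a lower bound for the number of heavy cells.

module _ {a b} {A : Set a} {B : Set b} (cell : B → List A) where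

  -- A cell satisfying `P` is charged its full capacity `k Q`, any other cell the allowance `y`.
  -- Granting the allowance to every cell replaces the number of light cells by the number of all
  -- cells.
  cells-total-≤ : ∀ {ℓ} {P : B → Set ℓ} (P? : Decidable P) k {Q y} zs →
    (∀ z → length (cell z) ℕ.≤ Q) → (∀ z → ¬ P z → k ℕ.* length (cell z) ℕ.≤ y) →
    k ℕ.* length (concatMap cell zs) ℕ.≤
      length (filter P? zs) ℕ.* (k ℕ.* Q) ℕ.+ length zs ℕ.* y
  cells-total-≤ P? k         []       _      _       = ℕ.≤-reflexive (ℕ.*-zeroʳ k)
  cells-total-≤ P? k {Q} {y} (z ∷ zs) cell≤Q light≤y = ℕ.≤-trans
    (ℕ.≤-reflexive (trans (cong (k ℕ.*_) (length-++ (cell z)))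
                          (ℕ.*-distribˡ-+ k (length (cell z)) _)))
    step
    where
    open ℕ.≤-Reasoning
    ih = cells-total-≤ P? k zs cell≤Q light≤y
    h = length (filter P? zs) ℕ.* (k ℕ.* Q)
    regroup-yes : ∀ a b c d → a ℕ.+ (b ℕ.+ (c ℕ.+ d)) ≡ (a ℕ.+ c) ℕ.+ (b ℕ.+ d)
    regroup-yes = solve-∀
    regroup-no : ∀ a b c → a ℕ.+ (b ℕ.+ c) ≡ b ℕ.+ (a ℕ.+ c)
    regroup-no = solve-∀
    step : k ℕ.* length (cell z) ℕ.+ k ℕ.* length (concatMap cell zs) ℕ.≤
      length (filter P? (z ∷ zs)) ℕ.* (k ℕ.* Q) ℕ.+ (y ℕ.+ length zs ℕ.* y)
    step with P? z
    ... | yes _ = begin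
      k ℕ.* length (cell z) ℕ.+ k ℕ.* length (concatMap cell zs)
        -- The summand `y` is the unspent allowance of a cell that satisfies `P`.
        ≤⟨ ℕ.+-mono-≤ (ℕ.*-monoʳ-≤ k (cell≤Q z)) (ℕ.m≤n⇒m≤o+n y ih) ⟩
      k ℕ.* Q ℕ.+ (y ℕ.+ (h ℕ.+ length zs ℕ.* y))
        ≡⟨ regroup-yes (k ℕ.* Q) y h _ ⟩
      (k ℕ.* Q ℕ.+ h) ℕ.+ (y ℕ.+ length zs ℕ.* y) ∎
    ... | no light = begin
      k ℕ.* length (cell z) ℕ.+ k ℕ.* length (concatMap cell zs)
        ≤⟨ ℕ.+-mono-≤ (light≤y z light) ih ⟩
      y ℕ.+ (h ℕ.+ length zs ℕ.* y)
        ≡⟨ regroup-no y h _ ⟩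
      h ℕ.+ (y ℕ.+ length zs ℕ.* y) ∎

  -- The condition `length (cell z) ≥ y / (4 r)` with its denominator cleared: `y / r` is the
  -- average over `r` cells.
  heavy? : ∀ y r → Decidable (λ z → y ℕ.≤ 4 ℕ.* r ℕ.* length (cell z))
  heavy? y r z = y ℕ.≤? 4 ℕ.* r ℕ.* length (cell z)

  -- With `r` cells, a light one has at most `y / (4 r)` points, so all light cells together have at
  -- most `y / 4`. The remaining `3 y / 4` points lie in heavy cells, each holding at most `Q`.
  heavy-cells-≥ : ∀ {Q ys} zs → (∀ z → length (cell z) ℕ.≤ Q) → Unique ys →
    (∀ {x} → x ∈ₗ ys → ∃ λ z → z ∈ₗ zs × x ∈ₗ cell z) →
    3 ℕ.* length ys ℕ.≤
      4 ℕ.* Q ℕ.* length (filter (heavy? (length ys) (length zs)) zs)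
  heavy-cells-≥ {ys = []}        []          _ _ _     = ℕ.z≤n
  heavy-cells-≥ {ys = _ ∷ _}     []          _ _ cover with () ← proj₁ (proj₂ (cover (here refl)))
  -- A nonempty `zs` makes `r` nonzero, so `r` can be cancelled; the term `r y` added on both sides
  -- is the allowance of the light cells.
  heavy-cells-≥ {Q} {ys} zs@(_ ∷ _) cell≤Q u cover =
    ℕ.*-cancelˡ-≤ r (ℕ.+-cancelʳ-≤ (r ℕ.* y) _ _ (begin
      r ℕ.* (3 ℕ.* y) ℕ.+ r ℕ.* y              ≡⟨ four r y ⟩
      4 ℕ.* r ℕ.* y                            ≤⟨ ℕ.*-monoʳ-≤ (4 ℕ.* r) y≤total ⟩
      4 ℕ.* r ℕ.* length (concatMap cell zs)
        ≤⟨ cells-total-≤ (heavy? y r) (4 ℕ.* r) zs cell≤Q (λ _ → ℕ.≰⇒≥) ⟩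
      h ℕ.* (4 ℕ.* r ℕ.* Q) ℕ.+ r ℕ.* y        ≡⟨ cong (ℕ._+ r ℕ.* y) (shuffle h r Q) ⟩
      r ℕ.* (4 ℕ.* Q ℕ.* h) ℕ.+ r ℕ.* y        ∎))
    where
    open ℕ.≤-Reasoning
    y = length ys
    r = length zs
    h = length (filter (heavy? y r) zs)
    y≤total : y ℕ.≤ length (concatMap cell zs)
    y≤total = unique-⊆⇒length≤ u λ x∈ys →
      let z , z∈zs , x∈z = cover x∈ys in ∈-concatMap⁺ cell (lose z∈zs x∈z)
    four : ∀ r y → r ℕ.* (3 ℕ.* y) ℕ.+ r ℕ.* y ≡ 4 ℕ.* r ℕ.* y
    four = solve-∀
    shuffle : ∀ h r Q → h ℕ.* (4 ℕ.* r ℕ.* Q) ≡ r ℕ.* (4 ℕ.* Q ℕ.* h)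
    shuffle = solve-∀

-- Enumeration of the vector space and elementary vector identities.

module _ {q : ℕ} (F : FiniteField q) where
  open FiniteField F

  allScalars : List Carrier
  allScalars = map (Inverse.from enumeration) (allFin q)

  length-allScalars : length allScalars ≡ q
  length-allScalars =
    trans (length-map (Inverse.from enumeration) (allFin q)) (length-tabulate {n = q} id)

  ∈-allScalars : ∀ x → x ∈ₗ allScalars
  ∈-allScalars x = subst (_∈ₗ allScalars) (Inverse.strictlyInverseʳ enumeration x)
    (∈-map⁺ (Inverse.from enumeration) (∈-allFin (Inverse.to enumeration x)))

  allScalars-unique : Unique allScalars
  allScalars-unique = Unique.map⁺
    (λ {i} {j} eq → trans (sym (Inverse.strictlyInverseˡ enumeration i))
      (trans (cong (Inverse.to enumeration) eq) (Inverse.strictlyInverseˡ enumeration j)))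
    (Unique.allFin⁺ q)

  allVectors : ∀ d → List (Vector F d)
  allVectors ℕ.zero    = [] ∷ []
  allVectors (ℕ.suc d) = cartesianProductWith _∷_ allScalars (allVectors d)

  length-allVectors : ∀ d → length (allVectors d) ≡ q ℕ.^ d
  length-allVectors ℕ.zero    = refl
  length-allVectors (ℕ.suc d) =
    trans (length-cartesianProductWith _∷_ allScalars (allVectors d))
          (cong₂ ℕ._*_ length-allScalars (length-allVectors d))

  ∈-allVectors : ∀ {d} (v : Vector F d) → v ∈ₗ allVectors d
  ∈-allVectors []      = here refl
  ∈-allVectors (x ∷ v) = ∈-cartesianProductWith⁺ _∷_ (∈-allScalars x) (∈-allVectors v)

  commutativeRing : CommutativeRing _ _
  commutativeRing = record { isCommutativeRing = isCommutativeRing }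

  open CommutativeRing commutativeRing using (ring; +-group; -‿inverseʳ; -‿inverseˡ;
    +-identityˡ; +-identityʳ; *-identityʳ; zeroʳ; *-comm; +-assoc)
  open RingProperties ring using (-‿distribˡ-*)
  open GroupProperties +-group using (∙-cancelʳ; inverseˡ-unique; ⁻¹-involutive)

  +ᵥ-cancelʳ : ∀ {d} (w : Vector F d) {u v} → _+ᵥ_ F d u w ≡ _+ᵥ_ F d v w → u ≡ v
  +ᵥ-cancelʳ []      {[]}    {[]}    _  = refl
  +ᵥ-cancelʳ (z ∷ w) {x ∷ u} {y ∷ v} eq =
    cong₂ _∷_ (∙-cancelʳ z x y (∷-injectiveˡ eq)) (+ᵥ-cancelʳ w (∷-injectiveʳ eq))

  +-scaled≡0⇒≡ : ∀ k {x y} → x + (- k) * y ≡ 0# → x ≡ k * y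
  +-scaled≡0⇒≡ k {x} {y} eq = trans (inverseˡ-unique x ((- k) * y) eq)
    (trans (cong -_ (sym (-‿distribˡ-* k y))) (⁻¹-involutive (k * y)))

  +ᵥ-scaled≡0⇒≡ : ∀ {d} k (u v : Vector F d) →
    _+ᵥ_ F d u (_·ᵥ_ F d (- k) v) ≡ 0ᵥ F d → u ≡ _·ᵥ_ F d k v
  +ᵥ-scaled≡0⇒≡ k []      []      _  = refl
  +ᵥ-scaled≡0⇒≡ k (x ∷ u) (y ∷ v) eq =
    cong₂ _∷_ (+-scaled≡0⇒≡ k (∷-injectiveˡ eq)) (+ᵥ-scaled≡0⇒≡ k u v (∷-injectiveʳ eq))

  -- The size of a joint fibre of two nonproportional pins.

  module _ {d : ℕ} (pairing : NondegeneratePairing F d) where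
    open NondegeneratePairing pairing
    open ≡-Reasoning
    private
      V = Vector F d
      _⊹_ = _+ᵥ_ F d
      _·_ = _·ᵥ_ F d
      infixl 6 _⊹_
      infixl 7 _·_

    pairing-⊹· : ∀ p v c w → ⟨ p , v ⊹ c · w ⟩ ≡ ⟨ p , v ⟩ + c * ⟨ p , w ⟩
    pairing-⊹· p v c w = trans (+-linearʳ p v (c · w)) (cong (⟨ p , v ⟩ +_) (·-linearʳ c p w))

    scale-to-1 : ∀ p w → ⟨ p , w ⟩ ≢ 0# → ∃ λ c → ⟨ p , c · w ⟩ ≡ 1#
    scale-to-1 p w p·w≢0 with inverse ⟨ p , w ⟩ p·w≢0
    ... | c , eq = c , trans (·-linearʳ c p w) (trans (*-comm c _) eq)

    -- Linear independence of `p` and `p′` in usable form: a shift along `u` changes only the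
    -- pairing with `p`, a shift along `v` only that with `p′`.
    record DualVectors (p p′ : V) : Set where
      field
        u v     : V
        ⟨p,u⟩≡1  : ⟨ p , u ⟩ ≡ 1#
        ⟨p,v⟩≡0  : ⟨ p , v ⟩ ≡ 0#
        ⟨p′,u⟩≡0 : ⟨ p′ , u ⟩ ≡ 0#
        ⟨p′,v⟩≡1 : ⟨ p′ , v ⟩ ≡ 1#

    -- Suppose no dual vectors exist. If some `w` had nonzero pairing with `p`, then pairing with
    -- `p′` would vanish on the kernel of pairing with `p`, making `p′` a multiple of `p`. So every
    -- pairing with `p` is zero and nondegeneracy gives `p ≡ 0`. The double negation avoids a search
    -- for `w`.
    nonproportional⇒¬¬dual : ∀ {p p′} → p ≢ 0ᵥ F d → ¬ Proportional F d p′ p →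
      ¬ ¬ DualVectors p p′
    nonproportional⇒¬¬dual {p} {p′} p≢0 p′∦p ¬dual =
      p≢0 (nondegenerateˡ p λ w → decidable-stable (⟨ p , w ⟩ ≟ 0#) (no-dual w))
      where
      no-dual : ∀ w → ¬ ¬ (⟨ p , w ⟩ ≡ 0#)
      no-dual w ⟨p,w⟩≢0 = p′∦p (k , +ᵥ-scaled≡0⇒≡ k p′ p (nondegenerateˡ _ residue≡0))
        where
        u₀ : V
        u₀ = proj₁ (scale-to-1 p w ⟨p,w⟩≢0) · w
        ⟨p,u₀⟩≡1 : ⟨ p , u₀ ⟩ ≡ 1#
        ⟨p,u₀⟩≡1 = proj₂ (scale-to-1 p w ⟨p,w⟩≢0)
        k : Carrier
        k = ⟨ p′ , u₀ ⟩
        -- Projection along `u₀` onto the kernel of pairing with `p`; a multiple of some projected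
        -- vector is to serve as `v`.
        project : V → V
        project x = x ⊹ (- ⟨ p , x ⟩) · u₀
        ⟨p,project⟩≡0 : ∀ x → ⟨ p , project x ⟩ ≡ 0#
        ⟨p,project⟩≡0 x = begin
          ⟨ p , project x ⟩                      ≡⟨ pairing-⊹· p x _ u₀ ⟩
          ⟨ p , x ⟩ + (- ⟨ p , x ⟩) * ⟨ p , u₀ ⟩ ≡⟨ cong (λ e → ⟨ p , x ⟩ + (- ⟨ p , x ⟩) * e) ⟨p,u₀⟩≡1 ⟩
          ⟨ p , x ⟩ + (- ⟨ p , x ⟩) * 1#         ≡⟨ cong (⟨ p , x ⟩ +_) (*-identityʳ _) ⟩
          ⟨ p , x ⟩ + (- ⟨ p , x ⟩)              ≡⟨ -‿inverseʳ _ ⟩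
          0#                                     ∎
        dual : ∀ x → ⟨ p′ , project x ⟩ ≢ 0# → DualVectors p p′
        dual x ⟨p′,v₀⟩≢0 = record
          -- Subtracting `k v` removes the pairing of `u₀` with `p′`, which is `k`, and keeps the
          -- pairing with `p`, because `v` is in the kernel.
          { u = u₀ ⊹ (- k) · v
          ; v = v
          ; ⟨p,u⟩≡1 = trans (pairing-⊹· p u₀ (- k) v)
              (trans (cong₂ _+_ ⟨p,u₀⟩≡1 (trans (cong ((- k) *_) ⟨p,v⟩≡0) (zeroʳ _))) (+-identityʳ 1#))
          ; ⟨p,v⟩≡0 = ⟨p,v⟩≡0
          ; ⟨p′,u⟩≡0 = trans (pairing-⊹· p′ u₀ (- k) v)
              (trans (cong (k +_) (trans (cong ((- k) *_) ⟨p′,v⟩≡1) (*-identityʳ _))) (-‿inverseʳ k))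
          ; ⟨p′,v⟩≡1 = ⟨p′,v⟩≡1
          }
          where
          scaling = scale-to-1 p′ (project x) ⟨p′,v₀⟩≢0
          v = proj₁ scaling · project x
          ⟨p′,v⟩≡1 = proj₂ scaling
          ⟨p,v⟩≡0 : ⟨ p , v ⟩ ≡ 0#
          ⟨p,v⟩≡0 = trans (·-linearʳ _ p (project x))
            (trans (cong (proj₁ scaling *_) (⟨p,project⟩≡0 x)) (zeroʳ _))
        -- Pairing `p′ - k p` with `x` gives the same value as pairing `p′` with `project x`; a
        -- nonzero value would produce dual vectors.
        residue≡0 : ∀ x → ⟨ p′ ⊹ (- k) · p , x ⟩ ≡ 0#
        residue≡0 x = begin
          ⟨ p′ ⊹ (- k) · p , x ⟩            ≡⟨ +-linearˡ p′ _ x ⟩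
          ⟨ p′ , x ⟩ + ⟨ (- k) · p , x ⟩    ≡⟨ cong (⟨ p′ , x ⟩ +_) (·-linearˡ (- k) p x) ⟩
          ⟨ p′ , x ⟩ + (- k) * ⟨ p , x ⟩    ≡⟨ cong (⟨ p′ , x ⟩ +_) (-‿distribˡ-* k _) ⟨
          ⟨ p′ , x ⟩ + (- (k * ⟨ p , x ⟩))  ≡⟨ cong (λ e → ⟨ p′ , x ⟩ + (- e)) (*-comm k _) ⟩
          ⟨ p′ , x ⟩ + (- (⟨ p , x ⟩ * k))  ≡⟨ cong (⟨ p′ , x ⟩ +_) (-‿distribˡ-* _ k) ⟩
          ⟨ p′ , x ⟩ + (- ⟨ p , x ⟩) * k    ≡⟨ pairing-⊹· p′ x _ u₀ ⟨
          ⟨ p′ , project x ⟩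
            ≡⟨ decidable-stable (⟨ p′ , project x ⟩ ≟ 0#) (¬dual ∘ dual x) ⟩
          0#                                ∎

    -- The translates of a joint fibre by a u + b v are pairwise disjoint,
    -- since the pairings with p and p′ recover a and b.
    dual⇒fibre-≤ : ∀ {p p′} → DualVectors p p′ → ∀ t t′ {xs} → Unique xs →
      (∀ {x} → x ∈ₗ xs → ⟨ p , x ⟩ ≡ t × ⟨ p′ , x ⟩ ≡ t′) →
      q ℕ.* q ℕ.* length xs ℕ.≤ q ℕ.^ d
    dual⇒fibre-≤ {p} {p′} dual t t′ {xs} u-xs fibre = bound
      where
      open DualVectors dual
      module R = ℕ.≤-Reasoning
      coefficients : List (Carrier × Carrier)
      coefficients = cartesianProduct allScalars allScalars
      shift : Carrier × Carrier → V
      shift (a , b) = a · u ⊹ b · v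
      translate : Carrier × Carrier → List V
      translate ab = map (_⊹ shift ab) xs
      recover : V → Carrier × Carrier
      recover z = ⟨ p , z ⟩ + (- t) , ⟨ p′ , z ⟩ + (- t′)
      ⟨p,shift⟩ : ∀ a b → ⟨ p , shift (a , b) ⟩ ≡ a
      ⟨p,shift⟩ a b = begin
        ⟨ p , shift (a , b) ⟩            ≡⟨ pairing-⊹· p (a · u) b v ⟩
        ⟨ p , a · u ⟩ + b * ⟨ p , v ⟩    ≡⟨ cong₂ _+_ (·-linearʳ a p u) (cong (b *_) ⟨p,v⟩≡0) ⟩
        a * ⟨ p , u ⟩ + b * 0#           ≡⟨ cong₂ _+_ (trans (cong (a *_) ⟨p,u⟩≡1) (*-identityʳ a)) (zeroʳ b) ⟩
        a + 0#                           ≡⟨ +-identityʳ a ⟩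
        a                                ∎
      ⟨p′,shift⟩ : ∀ a b → ⟨ p′ , shift (a , b) ⟩ ≡ b
      ⟨p′,shift⟩ a b = begin
        ⟨ p′ , shift (a , b) ⟩           ≡⟨ pairing-⊹· p′ (a · u) b v ⟩
        ⟨ p′ , a · u ⟩ + b * ⟨ p′ , v ⟩  ≡⟨ cong₂ _+_ (·-linearʳ a p′ u) (cong (b *_) ⟨p′,v⟩≡1) ⟩
        a * ⟨ p′ , u ⟩ + b * 1#          ≡⟨ cong₂ _+_ (trans (cong (a *_) ⟨p′,u⟩≡0) (zeroʳ a)) (*-identityʳ b) ⟩
        0# + b                           ≡⟨ +-identityˡ b ⟩
        b                                ∎
      cancel-t : ∀ s a → (s + a) + (- s) ≡ a
      cancel-t s a = begin
        (s + a) + (- s)  ≡⟨ +-comm (s + a) (- s) ⟩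
        (- s) + (s + a)  ≡⟨ +-assoc (- s) s a ⟨
        ((- s) + s) + a  ≡⟨ cong (_+ a) (-‿inverseˡ s) ⟩
        0# + a           ≡⟨ +-identityˡ a ⟩
        a                ∎
        where open CommutativeRing commutativeRing using (+-comm)
      recovers : ∀ ab {z} → z ∈ₗ translate ab → recover z ≡ ab
      recovers (a , b) z∈ with ∈-map⁻ (_⊹ shift (a , b)) z∈
      ... | x , x∈xs , refl = cong₂ _,_
        (trans (cong (_+ (- t)) (trans (+-linearʳ p x _)
          (cong₂ _+_ (proj₁ (fibre x∈xs)) (⟨p,shift⟩ a b)))) (cancel-t t a))
        (trans (cong (_+ (- t′)) (trans (+-linearʳ p′ x _)
          (cong₂ _+_ (proj₂ (fibre x∈xs)) (⟨p′,shift⟩ a b)))) (cancel-t t′ b))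
      translates-unique : Unique (concatMap translate coefficients)
      translates-unique = concatMap-unique recover
        (λ ab → Unique.map⁺ (+ᵥ-cancelʳ (shift ab)) u-xs) recovers
        (Unique.cartesianProduct⁺ allScalars-unique allScalars-unique)
      length-coefficients : length coefficients ≡ q ℕ.* q
      length-coefficients = trans (length-cartesianProductWith _,_ allScalars allScalars)
        (cong₂ ℕ._*_ length-allScalars length-allScalars)
      bound : q ℕ.* q ℕ.* length xs ℕ.≤ q ℕ.^ d
      bound = R.begin
        q ℕ.* q ℕ.* length xs                     R.≡⟨ cong (ℕ._* length xs) length-coefficients ⟨
        length coefficients ℕ.* length xs         R.≤⟨ length-concatMap-≥ (length xs) 1 coefficients
          (λ _ → ℕ.≤-reflexive (sym (trans (ℕ.*-identityˡ _) (length-map _ xs)))) ⟩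
        1 ℕ.* length (concatMap translate coefficients) R.≡⟨ ℕ.*-identityˡ _ ⟩
        length (concatMap translate coefficients) R.≤⟨ unique-⊆⇒length≤ translates-unique (λ _ → ∈-allVectors _) ⟩
        length (allVectors d)                     R.≡⟨ length-allVectors d ⟩
        q ℕ.^ d                                   R.∎

    -- The goal compares naturals, hence is stable under double negation, and the doubly negated
    -- dual vectors suffice. Since `d ≥ 2`, the factor `q²` splits off `q ^ d` and cancels.
    fibre-≤ : 2 ℕ.≤ d → ∀ {p p′} → p ≢ 0ᵥ F d → ¬ Proportional F d p′ p →
      ∀ t t′ {xs} → Unique xs →
      (∀ {x} → x ∈ₗ xs → ⟨ p , x ⟩ ≡ t × ⟨ p′ , x ⟩ ≡ t′) →
      length xs ℕ.≤ q ℕ.^ (d ℕ.∸ 2)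
    fibre-≤ 2≤d p≢0 p′∦p t t′ {xs} u-xs fibre =
      decidable-stable (length xs ℕ.≤? q ℕ.^ (d ℕ.∸ 2)) λ ≰ →
      nonproportional⇒¬¬dual p≢0 p′∦p λ dual →
      ≰ (ℕ.*-cancelˡ-≤ (q ℕ.* q) (subst (q ℕ.* q ℕ.* length xs ℕ.≤_) q^d≡
           (dual⇒fibre-≤ dual t t′ u-xs fibre)))
      where
      instance
        q≢0 : ℕ.NonZero q
        q≢0 = order-nonZero
        q*q≢0 : ℕ.NonZero (q ℕ.* q)
        q*q≢0 = ℕ.m*n≢0 q q
      q^d≡ : q ℕ.^ d ≡ q ℕ.* q ℕ.* q ℕ.^ (d ℕ.∸ 2)
      q^d≡ = trans (cong (q ℕ.^_) (sym (ℕ.m+[n∸m]≡n 2≤d))) (sym (ℕ.*-assoc q q _))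

-- Order arithmetic in the reals and the central inequality.

module RealProperties {c ℓ₁ ℓ₂} (ℝ : Reals c ℓ₁ ℓ₂) where
  open Reals ℝ renaming (refl to ≈-refl; sym to ≈-sym; trans to ≈-trans; reflexive to ≈-reflexive)
  open SemiringMult semiring using (×-homo-+; ×1-homo-*)
  open RingSolver commutativeSemiring using (solve; _:=_; _:*_)

  ≤-reflexive : ∀ {x y} → x ≈ y → x ≤ y
  ≤-reflexive x≈y = <-irrefl (≈-sym x≈y)

  ≤-respʳ-≈ : ∀ {x y z} → y ≈ z → x ≤ y → x ≤ z
  ≤-respʳ-≈ y≈z x≤y z<x = x≤y (<-respˡ-≈ (≈-sym y≈z) z<x)

  ≤-respˡ-≈ : ∀ {x y z} → y ≈ z → y ≤ x → z ≤ x
  ≤-respˡ-≈ y≈z y≤x x<z = y≤x (<-respʳ-≈ (≈-sym y≈z) x<z)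

  <⇒≤ : ∀ {x y} → x < y → x ≤ y
  <⇒≤ = <-asym

  <-≤-trans : ∀ {x y z} → x < y → y ≤ z → x < z
  <-≤-trans {z = z} x<y y≤z with <-cotrans x<y z
  ... | inj₁ x<z = x<z
  ... | inj₂ z<y = ⊥-elim (y≤z z<y)

  ≤-<-trans : ∀ {x y z} → x ≤ y → y < z → x < z
  ≤-<-trans {x} x≤y y<z with <-cotrans y<z x
  ... | inj₁ y<x = ⊥-elim (x≤y y<x)
  ... | inj₂ x<z = x<z

  ≤-trans : ∀ {x y z} → x ≤ y → y ≤ z → x ≤ z
  ≤-trans x≤y y≤z z<x = x≤y (≤-<-trans y≤z z<x)

  *-monoʳ-< : ∀ {x y z} → 0# < z → x < y → x * z < y * z
  *-monoʳ-< {x} {y} {z} 0<z x<y =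
    <-respˡ-≈ (+-identityˡ (x * z)) (<-respʳ-≈ eq
      (+-monoˡ-< (x * z) (*-positive (difference-pos x<y) 0<z)))
    where
    eq : (y - x) * z + x * z ≈ y * z
    eq = ≈-trans (≈-sym (distribʳ z (y - x) x))
           (*-congʳ (≈-trans (+-assoc y (- x) x)
             (≈-trans (+-congˡ (-‿inverseˡ x)) (+-identityʳ y))))

  *-cancelʳ-< : ∀ {x y z} → 0# < z → x * z < y * z → x < y
  *-cancelʳ-< {x} {y} {z} 0<z xz<yz with reciprocal 0<z
  ... | w , 0<w , zw≈1 = <-respˡ-≈ (undo x) (<-respʳ-≈ (undo y) (*-monoʳ-< 0<w xz<yz))
    where
    undo : ∀ t → t * z * w ≈ t
    undo t = ≈-trans (*-assoc t z w) (≈-trans (*-congˡ zw≈1) (*-identityʳ t))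

  -- No case split on `z = 0` or `z > 0` is available. If the products were in the wrong order,
  -- `z > 0` would contradict `x ≤ y` by cancellation, so `z ≈ 0` by tightness, and then both
  -- products are equal.
  *-monoʳ-≤ : ∀ {x y z} → 0# ≤ z → x ≤ y → x * z ≤ y * z
  *-monoʳ-≤ {x} {y} {z} 0≤z x≤y yz<xz = <-irrefl yz≈xz yz<xz
    where
    z≈0 : z ≈ 0#
    z≈0 = <-tight (λ 0<z → x≤y (*-cancelʳ-< 0<z yz<xz)) 0≤z
    yz≈xz : y * z ≈ x * z
    yz≈xz = ≈-trans (≈-trans (*-congˡ z≈0) (zeroʳ y))
                    (≈-sym (≈-trans (*-congˡ z≈0) (zeroʳ x)))

  *-monoˡ-≤ : ∀ {x y z} → 0# ≤ z → x ≤ y → z * x ≤ z * y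
  *-monoˡ-≤ 0≤z x≤y = ≤-respˡ-≈ (*-comm _ _) (≤-respʳ-≈ (*-comm _ _) (*-monoʳ-≤ 0≤z x≤y))

  *-mono-≤ : ∀ {w x y z} → 0# ≤ x → 0# ≤ y → w ≤ x → y ≤ z → w * y ≤ x * z
  *-mono-≤ 0≤x 0≤y w≤x y≤z = ≤-trans (*-monoʳ-≤ 0≤y w≤x) (*-monoˡ-≤ 0≤x y≤z)

  *-nonneg : ∀ {x y} → 0# ≤ x → 0# ≤ y → 0# ≤ x * y
  *-nonneg {y = y} 0≤x 0≤y = ≤-respˡ-≈ (zeroˡ y) (*-monoʳ-≤ 0≤y 0≤x)

  square-mono-< : ∀ {x y} → 0# ≤ x → x < y → x * x < y * y
  square-mono-< 0≤x x<y = ≤-<-trans (*-monoˡ-≤ 0≤x (<⇒≤ x<y)) (*-monoʳ-< (≤-<-trans 0≤x x<y) x<y)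

  fromℕ-* : ∀ m n → fromℕ (m ℕ.* n) ≈ fromℕ m * fromℕ n
  fromℕ-* = ×1-homo-*

  fromℕ-nonneg : ∀ n → 0# ≤ fromℕ n
  fromℕ-nonneg ℕ.zero      = ≤-reflexive ≈-refl
  fromℕ-nonneg n@(ℕ.suc _) = <⇒≤ (fromℕ-pos n)

  fromℕ-mono-≤ : ∀ {m n} → m ℕ.≤ n → fromℕ m ≤ fromℕ n
  fromℕ-mono-≤ {m} {n} m≤n n<m = fromℕ-nonneg (n ℕ.∸ m) (<-cancel (<-respˡ-≈ eq n<m))
    where
    eq : fromℕ n ≈ fromℕ (n ℕ.∸ m) + fromℕ m
    eq = ≈-trans (≈-reflexive (cong fromℕ (sym (ℕ.m∸n+n≡m m≤n)))) (×-homo-+ 1# (n ℕ.∸ m) m)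
    <-cancel : ∀ {x y} → x + y < y → x < 0#
    <-cancel {x} {y} x+y<y = <-respˡ-≈
      (≈-trans (+-assoc x y (- y)) (≈-trans (+-congˡ (-‿inverseʳ y)) (+-identityʳ x)))
      (<-respʳ-≈ (-‿inverseʳ y) (+-monoˡ-< (- y) x+y<y))

  quotient-≤-fromℕ : ∀ {k} w n (0<w : 0# < fromℕ w) → k ℕ.≤ w ℕ.* n →
    fromℕ k / fromℕ w [ 0<w ] ≤ fromℕ n
  quotient-≤-fromℕ {k} w n 0<w k≤wn n<k/w with reciprocal 0<w
  ... | v , _ , wv≈1 = fromℕ-mono-≤ k≤wn
    (<-respˡ-≈ (≈-trans (*-comm _ _) (≈-sym (fromℕ-* w n)))
      (<-respʳ-≈ undo (*-monoʳ-< 0<w n<k/w)))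
    where
    undo : fromℕ k * v * fromℕ w ≈ fromℕ k
    undo = ≈-trans (*-assoc _ v _) (≈-trans (*-congˡ (≈-trans (*-comm v _) wv≈1)) (*-identityʳ _))

  cube : ∀ x → x ^ 3 ≈ x * (x * x)
  cube x = *-congˡ (*-congˡ (*-identityʳ x))

  square : ∀ x → x ^ 2 ≈ x * x
  square x = *-congˡ (*-identityʳ x)

  -- Squaring n < a ρ u and clearing denominators turns it into
  -- (X C)² < (a² y C)² with X = k e² Q² n, although a² y ≤ y ≤ X.
  richness : ∀ {a e C s ρ u κ Q m y n k} →
    0# < a → a ≤ 1# → 0# < e → 0# < C → s * s ≈ e →
    0# < k * C * s → k * C * s * ρ ≈ 1# →
    0# < Q → Q * κ ≈ 1# → u * u ≈ m * y * κ →
    0# ≤ y → 0# ≤ n →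
    y ≤ k * ((e * Q) * (e * Q)) * n →
    e ^ 3 * m * Q ^ 3 ≤ C ^ 2 * a ^ 2 * y →
    a * ρ * u ≤ n
  richness {a} {e} {C} {s} {ρ} {u} {κ} {Q} {m} {y} {n} {k}
    0<a a≤1 0<e 0<C s²≈e 0<D Dρ≈1 0<Q Qκ≈1 u²≈myκ 0≤y 0≤n y≤X hyp n<aρu =
    <-irrefl ≈-refl (≤-<-trans square-≤ cleared)
    where
    -- In the application `a = α`, `e = 1 - α`, `s = √ e`, `k = 8`, `u = √ (m y / Q)`, and `ρ`, `κ`
    -- are the reciprocals of `D` and `Q`.
    D = k * C * s
    X = k * ((e * Q) * (e * Q)) * n
    0≤a = <⇒≤ 0<a
    0≤C = <⇒≤ 0<C

    scaled : n * D < a * u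
    scaled = <-respʳ-≈ (≈-trans (rearrange a ρ u D) (≈-trans (*-congˡ Dρ≈1) (*-identityʳ _)))
                       (*-monoʳ-< 0<D n<aρu)
      where
      rearrange : ∀ a ρ u D → a * ρ * u * D ≈ a * u * (D * ρ)
      rearrange = solve 4 (λ a ρ u D → a :* ρ :* u :* D := a :* u :* (D :* ρ)) ≈-refl

    squared : n * D * (n * D) * Q < a * a * m * y
    squared = <-respʳ-≈ right
      (*-monoʳ-< 0<Q (square-mono-< (*-nonneg 0≤n (<⇒≤ 0<D)) scaled))
      where
      right : a * u * (a * u) * Q ≈ a * a * m * y
      right = ≈-trans
        (solve 3 (λ a u Q → a :* u :* (a :* u) :* Q := a :* a :* (u :* u) :* Q) ≈-refl a u Q)
        (≈-trans (*-congʳ (*-congˡ u²≈myκ))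
        (≈-trans (solve 5 (λ a m y κ Q → a :* a :* (m :* y :* κ) :* Q := a :* a :* m :* y :* (Q :* κ))
                    ≈-refl a m y κ Q)
        (≈-trans (*-congˡ Qκ≈1) (*-identityʳ _))))

    -- This multiplier serves both sides: with `s² ≈ e` the left becomes a perfect square in
    -- `e² Q²`, and on the right it completes `m` to the left side of the density hypothesis.
    e³Q³ = (e * (e * e)) * (Q * (Q * Q))

    0<e³Q³ : 0# < e³Q³
    0<e³Q³ = *-positive (*-positive 0<e (*-positive 0<e 0<e)) (*-positive 0<Q (*-positive 0<Q 0<Q))

    left : n * D * (n * D) * Q * e³Q³ ≈ X * C * (X * C)
    left = ≈-trans
      (solve 6 (λ n k C s Q e →
        n :* (k :* C :* s) :* (n :* (k :* C :* s)) :* Q :* ((e :* (e :* e)) :* (Q :* (Q :* Q))) :=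
        (s :* s) :* (n :* n :* k :* k :* C :* C :* Q :* Q :* Q :* Q :* e :* e :* e)) ≈-refl n k C s Q e)
      (≈-trans (*-congʳ s²≈e)
      (solve 5 (λ n k C Q e →
        e :* (n :* n :* k :* k :* C :* C :* Q :* Q :* Q :* Q :* e :* e :* e) :=
        (k :* ((e :* Q) :* (e :* Q)) :* n) :* C :* ((k :* ((e :* Q) :* (e :* Q)) :* n) :* C))
        ≈-refl n k C Q e))

    hyp-≤ : a * a * m * y * e³Q³ ≤ a * a * y * C * (a * a * y * C)
    hyp-≤ = ≤-respˡ-≈ toˡ (≤-respʳ-≈ toʳ (*-monoˡ-≤ (*-nonneg (*-nonneg 0≤a 0≤a) 0≤y) hyp))
      where
      toˡ : a * a * y * (e ^ 3 * m * Q ^ 3) ≈ a * a * m * y * e³Q³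
      toˡ = ≈-trans (*-congˡ (*-cong (*-congʳ (cube e)) (cube Q)))
        (solve 5 (λ a y e m Q → a :* a :* y :* ((e :* (e :* e)) :* m :* (Q :* (Q :* Q))) :=
           a :* a :* m :* y :* ((e :* (e :* e)) :* (Q :* (Q :* Q)))) ≈-refl a y e m Q)
      toʳ : a * a * y * (C ^ 2 * a ^ 2 * y) ≈ a * a * y * C * (a * a * y * C)
      toʳ = ≈-trans (*-congˡ (*-congʳ (*-cong (square C) (square a))))
        (solve 3 (λ a y C → a :* a :* y :* (C :* C :* (a :* a) :* y) :=
           a :* a :* y :* C :* (a :* a :* y :* C)) ≈-refl a y C)

    cleared : X * C * (X * C) < a * a * y * C * (a * a * y * C)
    cleared = <-respˡ-≈ left (<-≤-trans (*-monoʳ-< 0<e³Q³ squared) hyp-≤)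

    a²yC≤XC : a * a * y * C ≤ X * C
    a²yC≤XC = *-monoʳ-≤ 0≤C (≤-trans (≤-respʳ-≈ (*-identityˡ y)
      (*-monoʳ-≤ 0≤y (≤-respʳ-≈ (*-identityˡ 1#) (*-mono-≤ (<⇒≤ 0<1) 0≤a a≤1 a≤1)))) y≤X)

    square-≤ : a * a * y * C * (a * a * y * C) ≤ X * C * (X * C)
    square-≤ = *-mono-≤ (≤-trans 0≤a²yC a²yC≤XC) 0≤a²yC a²yC≤XC a²yC≤XC
      where
      0≤a²yC : 0# ≤ a * a * y * C
      0≤a²yC = *-nonneg (*-nonneg (*-nonneg 0≤a 0≤a) 0≤y) 0≤C

-- From the size of a heavy cell to the richness bound.

module RichnessBound {c ℓ₁ ℓ₂} (ℝ : Reals c ℓ₁ ℓ₂) {q : ℕ} (F : FiniteField q) where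
  open Reals ℝ renaming (refl to ≈-refl; sym to ≈-sym; trans to ≈-trans)
  open RealProperties ℝ
  open Bounds ℝ F

  -- `x` stands for `(1 - α) q`. The constant 4 of heaviness is weakened to the 8 in the denominator
  -- of the richness bound, so a factor of 2 is given away.
  point-count-≤ : ∀ {y r r′ n x} → 0# ≤ x → fromℕ r ≤ x → fromℕ r′ ≤ x →
    y ℕ.≤ 4 ℕ.* (r ℕ.* r′) ℕ.* n → fromℕ y ≤ fromℕ 8 * (x * x) * fromℕ n
  point-count-≤ {y} {r} {r′} {n} {x} 0≤x r≤ r′≤ heavy = ≤-trans
    (≤-respʳ-≈ eq
      (fromℕ-mono-≤ (ℕ.≤-trans heavy
        (ℕ.*-monoˡ-≤ n (ℕ.*-monoˡ-≤ (r ℕ.* r′) (ℕ.m≤m+n 4 4))))))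
    (*-monoʳ-≤ (fromℕ-nonneg n) (*-monoˡ-≤ (fromℕ-nonneg 8)
      (*-mono-≤ 0≤x (fromℕ-nonneg r′) r≤ r′≤)))
    where
    eq : fromℕ (8 ℕ.* (r ℕ.* r′) ℕ.* n) ≈ fromℕ 8 * (fromℕ r * fromℕ r′) * fromℕ n
    eq = ≈-trans (fromℕ-* (8 ℕ.* (r ℕ.* r′)) n)
           (*-congʳ (≈-trans (fromℕ-* 8 (r ℕ.* r′)) (*-congˡ (fromℕ-* r r′))))

  richnessBound-≤ : ∀ {m y n α C₁} (α<1 : α < 1#) (1≤C₁ : 1# ≤ C₁) → 0# < α →
    fromℕ y ≤ fromℕ 8 * (((1# - α) * fromℕ q) * ((1# - α) * fromℕ q)) * fromℕ n →
    (1# - α) ^ 3 * fromℕ m * fromℕ q ^ 3 ≤ C₁ ^ 2 * α ^ 2 * fromℕ y →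
    richnessBound m y α C₁ α<1 1≤C₁ ≤ fromℕ n
  richnessBound-≤ {m} {y} {n} {α} {C₁} α<1 1≤C₁ 0<α y≤ hyp =
    richness {e = 1# - α} {C = C₁} {s = √ (1# - α)} {Q = fromℕ q} {k = fromℕ 8}
      0<α (<⇒≤ α<1) 0<e 0<C₁ (√-square (<⇒≤ 0<e)) 0<D (proj₂ (proj₂ (reciprocal 0<D)))
      0<q (proj₂ (proj₂ (reciprocal 0<q)))
      (≈-trans (√-square 0≤my/q) (*-congʳ (fromℕ-* m y)))
      (fromℕ-nonneg y) (fromℕ-nonneg n) y≤ hyp
    where
    0<e = difference-pos α<1
    0<C₁ = 1≤⇒pos 1≤C₁
    -- A quotient refers to the positivity proof of its denominator, so this proof and `0<D` repeat
    -- the ones inside `richnessBound`.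
    0<q = fromℕ-pos q {{FiniteField.order-nonZero F}}
    0<D : 0# < fromℕ 8 * C₁ * √ (1# - α)
    0<D = *-positive (*-positive (fromℕ-pos 8) 0<C₁) (√-pos 0<e)
    0≤my/q : 0# ≤ fromℕ (m ℕ.* y) / fromℕ q [ 0<q ]
    0≤my/q = *-nonneg (fromℕ-nonneg (m ℕ.* y)) (<⇒≤ (proj₁ (proj₂ (reciprocal 0<q))))

-- Collecting the heavy cells over all ordered pairs of distinct pins.

module HeavyChoices {q : ℕ} {F : FiniteField q} {d : ℕ} (2≤d : 2 ℕ.≤ d)
  (pairing : NondegeneratePairing F d) (Y T : FinSet (Vector F d))
  (T≢0 : ∀ {p} → p ∈ T → p ≢ 0ᵥ F d) (T∦ : PairwiseNonproportional F d T) where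
  open Pins pairing
  open NondegeneratePairing pairing
  open FiniteField F using (_≟_) renaming (Carrier to 𝔽)

  private
    V = Vector F d
    Q = q ℕ.^ (d ℕ.∸ 2)

  _≟ᵥ_ : DecidableEquality V
  _≟ᵥ_ = ≡-dec _≟_

  otherPins : V → List V
  otherPins p = filter (λ p′ → ¬? (p ≟ᵥ p′)) (FinSet.elements T)

  pinPairs : List (V × V)
  pinPairs = concatMap (λ p → map (p ,_) (otherPins p)) (FinSet.elements T)

  ∈-pinPairs⁻ : ∀ {p p′} → (p , p′) ∈ₗ pinPairs → p ∈ T × p′ ∈ T × p ≢ p′
  ∈-pinPairs⁻ pp′∈ with find (∈-concatMap⁻ (λ p → map (p ,_) (otherPins p)) {xs = FinSet.elements T} pp′∈)
  ... | p , p∈T , pp′∈p with ∈-map⁻ (p ,_) pp′∈p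
  ... | p′ , p′∈ , refl with ∈-filter⁻ (λ p′ → ¬? (p ≟ᵥ p′)) p′∈
  ... | p′∈T , p≢p′ = p∈T , p′∈T , p≢p′

  pinPairs-unique : Unique pinPairs
  pinPairs-unique = concatMap-unique proj₁
    (λ p → Unique.map⁺ ,-injectiveʳ (Unique.filter⁺ (λ p′ → ¬? (p ≟ᵥ p′)) (FinSet.unique T)))
    (λ p z∈ → cong proj₁ (proj₂ (proj₂ (∈-map⁻ (p ,_) z∈))))
    (FinSet.unique T)

  -- Putting `p` back among the other pins covers `T`, so every pin has at least `∣ T ∣ - 1`
  -- partners.
  length-pinPairs-≥ : ∣ T ∣ ℕ.* (∣ T ∣ ℕ.∸ 1) ℕ.≤ length pinPairs
  length-pinPairs-≥ = ℕ.≤-trans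
    (length-concatMap-≥ (∣ T ∣ ℕ.∸ 1) 1 (FinSet.elements T) λ {p} _ → ℕ.≤-trans
      (ℕ.∸-monoˡ-≤ 1 (unique-⊆⇒length≤ (FinSet.unique T) (self-or-other p)))
      (ℕ.≤-reflexive (sym (trans (ℕ.*-identityˡ _) (length-map (p ,_) (otherPins p))))))
    (ℕ.≤-reflexive (ℕ.*-identityˡ _))
    where
    self-or-other : ∀ p {x} → x ∈ T → x ∈ₗ p ∷ otherPins p
    self-or-other p {x} x∈T with p ≟ᵥ x
    ... | yes refl = here refl
    ... | no p≢x   = there (∈-filter⁺ (λ p′ → ¬? (p ≟ᵥ p′)) x∈T p≢x)

  assemble : V × V → 𝔽 × 𝔽 → Choice
  assemble (p , p′) (t , t′) = (p , t) , (p′ , t′)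

  fibre : V × V → 𝔽 × 𝔽 → List V
  fibre pp′ tt′ = FinSet.elements (jointFibre Y (assemble pp′ tt′))

  valuePairs : V × V → List (𝔽 × 𝔽)
  valuePairs (p , p′) = cartesianProduct (FinSet.elements (Π p Y)) (FinSet.elements (Π p′ Y))

  -- The average is over the actual number of pairs of attained values, so no real number enters;
  -- the estimate by `(1 - α)² q²` is applied only when heavy cells are shown to be rich.
  heavyValues : V × V → List (𝔽 × 𝔽)
  heavyValues pp′ = filter (heavy? (fibre pp′) (∣ Y ∣) (length (valuePairs pp′))) (valuePairs pp′)

  ∈-Π : ∀ p {x} → x ∈ Y → ⟨ p , x ⟩ ∈ Π p Y
  ∈-Π p x∈Y = ∈-deduplicate⁺ _≟_ (∈-map⁺ ⟨ p ,_⟩ x∈Y)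

  heavyValues-≥ : ∀ {pp′} → pp′ ∈ₗ pinPairs →
    3 ℕ.* ∣ Y ∣ ℕ.≤ 4 ℕ.* Q ℕ.* length (heavyValues pp′)
  heavyValues-≥ {pp′@(p , p′)} pp′∈ = heavy-cells-≥ (fibre pp′) (valuePairs pp′) fibre≤Q
    (FinSet.unique Y)
    -- Each point of `Y` lies in the cell given by its own two pairings.
    λ {x} x∈Y → (⟨ p , x ⟩ , ⟨ p′ , x ⟩)
      , ∈-cartesianProduct⁺ (∈-Π p x∈Y) (∈-Π p′ x∈Y)
      , ∈-filter⁺ _ x∈Y (refl , refl)
    where
    distinct = ∈-pinPairs⁻ pp′∈
    fibre≤Q : ∀ tt′ → length (fibre pp′ tt′) ℕ.≤ Q
    fibre≤Q (t , t′) = fibre-≤ F pairing 2≤d (T≢0 (proj₁ distinct))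
      (T∦ (proj₁ (proj₂ distinct)) (proj₁ distinct) (proj₂ (proj₂ distinct) ∘ sym))
      t t′ (FinSet.unique (jointFibre Y (assemble pp′ (t , t′))))
      (λ x∈ → proj₂ (∈-filter⁻ _ {xs = FinSet.elements Y} x∈))

  choicesAt : V × V → List Choice
  choicesAt pp′ = map (assemble pp′) (heavyValues pp′)

  pinsOf : Choice → V × V
  pinsOf ((p , _) , (p′ , _)) = p , p′

  pinsOf-choicesAt : ∀ pp′ {χ} → χ ∈ₗ choicesAt pp′ → pinsOf χ ≡ pp′
  pinsOf-choicesAt pp′ χ∈ with ∈-map⁻ (assemble pp′) χ∈
  ... | _ , _ , refl = refl

  choicesAt-unique : ∀ pp′ → Unique (choicesAt pp′)
  choicesAt-unique pp′@(p , p′) = Unique.map⁺ assemble-injective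
    (Unique.filter⁺ (heavy? (fibre pp′) (∣ Y ∣) (length (valuePairs pp′)))
      (Unique.cartesianProduct⁺ (FinSet.unique (Π p Y)) (FinSet.unique (Π p′ Y))))
    where
    assemble-injective : ∀ {tt′ uu′} → assemble pp′ tt′ ≡ assemble pp′ uu′ → tt′ ≡ uu′
    assemble-injective refl = refl

  heavyChoices : FinSet Choice
  heavyChoices = concatMap choicesAt pinPairs ,
    concatMap-unique pinsOf choicesAt-unique pinsOf-choicesAt pinPairs-unique

  ∣heavyChoices∣-≥ :
    3 ℕ.* ∣ Y ∣ ℕ.* ∣ T ∣ ℕ.* (∣ T ∣ ℕ.∸ 1) ℕ.≤ 4 ℕ.* Q ℕ.* ∣ heavyChoices ∣
  ∣heavyChoices∣-≥ = begin
    3 ℕ.* ∣ Y ∣ ℕ.* ∣ T ∣ ℕ.* (∣ T ∣ ℕ.∸ 1)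
      ≡⟨ ℕ.*-assoc (3 ℕ.* ∣ Y ∣) ∣ T ∣ _ ⟩
    3 ℕ.* ∣ Y ∣ ℕ.* (∣ T ∣ ℕ.* (∣ T ∣ ℕ.∸ 1))
      ≤⟨ ℕ.*-monoʳ-≤ (3 ℕ.* ∣ Y ∣) length-pinPairs-≥ ⟩
    3 ℕ.* ∣ Y ∣ ℕ.* length pinPairs
      ≡⟨ ℕ.*-comm (3 ℕ.* ∣ Y ∣) _ ⟩
    length pinPairs ℕ.* (3 ℕ.* ∣ Y ∣)
      ≤⟨ length-concatMap-≥ (3 ℕ.* ∣ Y ∣) (4 ℕ.* Q) pinPairs (λ {pp′} pp′∈ →
           subst (λ l → 3 ℕ.* ∣ Y ∣ ℕ.≤ 4 ℕ.* Q ℕ.* l)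
             (sym (length-map (assemble pp′) (heavyValues pp′))) (heavyValues-≥ pp′∈)) ⟩
    4 ℕ.* Q ℕ.* ∣ heavyChoices ∣ ∎
    where open ℕ.≤-Reasoning

  -- Here the number of cells is written as the product of the two image sizes, the form in which
  -- the bounds for the single pins apply.
  ∈-heavyChoices⁻ : ∀ {χ@((p , _) , (p′ , _)) : Choice} → χ ∈ heavyChoices →
    IsAdmissible Y T χ ×
    ∣ Y ∣ ℕ.≤ 4 ℕ.* (∣ Π p Y ∣ ℕ.* ∣ Π p′ Y ∣) ℕ.* ∣ jointFibre Y χ ∣
  ∈-heavyChoices⁻ χ∈ with find (∈-concatMap⁻ choicesAt {xs = pinPairs} χ∈)
  ... | pp′@(p , p′) , pp′∈ , χ∈pp′ with ∈-map⁻ (assemble pp′) χ∈pp′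
  ... | tt′@(t , t′) , tt′∈ , refl
    with ∈-filter⁻ (heavy? (fibre pp′) (∣ Y ∣) (length (valuePairs pp′))) {xs = valuePairs pp′} tt′∈
       | ∈-pinPairs⁻ pp′∈
  ... | tt′∈values , heavy | p∈T , p′∈T , p≢p′ with ∈-cartesianProduct⁻ (FinSet.elements (Π p Y)) _ tt′∈values
  ... | t∈ , t′∈ = (p∈T , p′∈T , p≢p′ , t∈ , t′∈) ,
    subst (λ r → ∣ Y ∣ ℕ.≤ 4 ℕ.* r ℕ.* ∣ jointFibre Y (assemble pp′ tt′) ∣)
      (length-cartesianProductWith _,_ (FinSet.elements (Π p Y)) (FinSet.elements (Π p′ Y))) heavy

  -- Existence follows from the count: its lower bound is positive as `Y` is nonempty and there are
  -- at least two pins.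
  heavyChoices-nonempty : Nonempty Y → 2 ℕ.≤ ∣ T ∣ → Nonempty heavyChoices
  heavyChoices-nonempty (_ , x∈Y) 2≤m = nonempty (FinSet.elements heavyChoices)
    (ℕ.≤-trans positive ∣heavyChoices∣-≥)
    where
    positive : 1 ℕ.≤ 3 ℕ.* ∣ Y ∣ ℕ.* ∣ T ∣ ℕ.* (∣ T ∣ ℕ.∸ 1)
    positive = ℕ.*-mono-≤ {1} (ℕ.*-mono-≤ {1} (ℕ.*-mono-≤ {1} {3} (ℕ.s≤s ℕ.z≤n) (∈-length x∈Y))
      (ℕ.<⇒≤ 2≤m)) (ℕ.∸-monoˡ-≤ 1 2≤m)
    nonempty : ∀ xs → 1 ℕ.≤ 4 ℕ.* Q ℕ.* length xs → ∃ (_∈ₗ xs)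
    nonempty []      1≤0 with () ← subst (1 ℕ.≤_) (ℕ.*-zeroʳ (4 ℕ.* Q)) 1≤0
    nonempty (x ∷ _) _   = x , here refl

theorem5p5 :
    ∀ {c ℓ₁ ℓ₂} (ℝ : Reals c ℓ₁ ℓ₂) (let open Reals ℝ)
    (q : ℕ) → IsPrimePower q → (F : FiniteField q) →
    (d : ℕ) → 2 ℕ.≤ d →
    (pairing : NondegeneratePairing F d) (let open Pins pairing) →
    (Y : FinSet (Vector F d)) → Nonempty Y →
    (T : FinSet (Vector F d)) → 2 ℕ.≤ ∣ T ∣ →
    (∀ {p} → p ∈ T → p ≢ 0ᵥ F d) → PairwiseNonproportional F d T →
    (α : Carrier) → 0# < α → (α<1 : α < 1#) →
    (∀ {p} → p ∈ T → fromℕ ∣ Π p Y ∣ ≤ (1# - α) * fromℕ q) →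
    (C₁ : Carrier) → (1≤C₁ : 1# ≤ C₁) →
    (1# - α) ^ 3 * fromℕ ∣ T ∣ * fromℕ q ^ 3 ≤ C₁ ^ 2 * α ^ 2 * fromℕ ∣ Y ∣ →
    let
      open Bounds ℝ F
      IsRich = λ (χ : Choice) →
        richnessBound (∣ T ∣) (∣ Y ∣) α C₁ α<1 1≤C₁
          ≤ fromℕ (∣ jointFibre Y χ ∣)
    in
    (∃ λ (χ : Choice) → IsAdmissible Y T χ × IsRich χ)
    ×
    -- IsRich compares real numbers, so it is not assumed decidable; at
    -- least N choices means a duplicate-free collection of N or more of them.
    (∃ λ (S : FinSet Choice) →
      (∀ {χ} → χ ∈ S → IsAdmissible Y T χ × IsRich χ)
      × countBound (∣ T ∣) (∣ Y ∣) d ≤ fromℕ (∣ S ∣))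
theorem5p5 ℝ q _ F d 2≤d pairing Y Y≢∅ T 2≤m T≢0 T∦ α 0<α α<1 Π≤ C₁ 1≤C₁ hyp =
  -- Any heavy choice proves the first claim; the set of all of them proves the second.
  (let χ , χ∈ = heavyChoices-nonempty Y≢∅ 2≤m in χ , admissible-rich χ∈) ,
  heavyChoices , admissible-rich , count
  where
  open Reals ℝ hiding (refl; sym; trans)
  open RealProperties ℝ
  open RichnessBound ℝ F
  open Pins pairing
  open HeavyChoices 2≤d pairing Y T T≢0 T∦
  open Bounds ℝ F

  0≤[1-α]q : 0# ≤ (1# - α) * fromℕ q
  0≤[1-α]q = *-nonneg (<⇒≤ (difference-pos α<1)) (fromℕ-nonneg q)

  admissible-rich : ∀ {χ} → χ ∈ heavyChoices → IsAdmissible Y T χ ×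
    richnessBound (∣ T ∣) (∣ Y ∣) α C₁ α<1 1≤C₁ ≤ fromℕ (∣ jointFibre Y χ ∣)
  admissible-rich {χ@((p , _) , (p′ , _))} χ∈ =
    let admissible@(p∈T , p′∈T , _) , heavy = ∈-heavyChoices⁻ χ∈ in
    admissible , richnessBound-≤ {m = ∣ T ∣} {n = ∣ jointFibre Y χ ∣} α<1 1≤C₁ 0<α
      (point-count-≤ {r = ∣ Π p Y ∣} {r′ = ∣ Π p′ Y ∣} 0≤[1-α]q (Π≤ p∈T) (Π≤ p′∈T) heavy) hyp

  count : countBound (∣ T ∣) (∣ Y ∣) d ≤ fromℕ (∣ heavyChoices ∣)
  count = quotient-≤-fromℕ {k = 3 ℕ.* ∣ Y ∣ ℕ.* ∣ T ∣ ℕ.* (∣ T ∣ ℕ.∸ 1)}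
    (4 ℕ.* q ℕ.^ (d ℕ.∸ 2)) ∣ heavyChoices ∣ _ ∣heavyChoices∣-≥
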